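{- Let $d\ge 2$ and let $\vec a=(a_1,\ldots,a_d)$ be a vector of relatively prime positive integers. The body $\mathcal{H}_{\vec a}\setminus\mathcal{Q}$ of the Christoffel graph $\mathcal{H}_{\vec a}$ is symmetric, i.e. $-(\mathcal{H}_{\vec a}\setminus\mathcal{Q})=\mathcal{H}_{\vec a}\setminus\mathcal{Q}$.
   Context: $e_1,\ldots,e_d$ is the standard basis of $\mathbb{Z}^d$ and $\mathbb{E}_d=\{(u,u+e_i): u\in\mathbb{Z}^d,\ 1\le i\le d\}$. "Relatively prime" means $\gcd(a_1,\ldots,a_d)=1$. Put $s=\sum_i a_i$ and let $\mathcal{F}_{\vec a}:\mathbb{Z}^d\to\mathbb{Z}/s\mathbb{Z}$, $(x_1,\ldots,x_d)\mapsto\sum_i a_ix_i\bmod s$, where $\mathbb{Z}/s\mathbb{Z}$ is identified with $\{0,1,\ldots,s-1\}$ with its usual total order. The Christoffel graph of normal vector $\vec a$ is $\mathcal{H}_{\vec a}=\{(u,u+e_i)\in\mathbb{E}_d:\mathcal{F}_{\vec a}(u)<\mathcal{F}_{\vec a}(u+e_i)\}$. The set of edges incident to zero is $\mathcal{Q}=\{(u,v)\in\mathbb{E}_d:\mathcal{F}_{\vec a}(u)=0\text{ or }\mathcal{F}_{\vec a}(v)=0\}$. The body of $X\subseteq\mathbb{E}_d$ is $X\setminus\mathcal{Q}$. The reversal of $X\subseteq\mathbb{E}_d$ is $-X=\{(-v,-u)\mid(u,v)\in X\}$. -}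

module Defs where

open import Data.Fin using (Fin; toℕ; fromℕ<)
import Data.Fin as Fin
open import Data.Integer using (ℤ; +_; -_; 0ℤ; 1ℤ; _%ℕ_)
import Data.Integer as ℤ
open import Data.Integer.DivMod using (n%ℕd<d)
open import Data.Nat using (ℕ; zero; suc; _≤_; _<_; NonZero)
open import Data.Nat.GCD using (gcd)
open import Data.Product using (_×_; _,_; ∃-syntax)
open import Data.Sum using (_⊎_)
open import Data.Vec using (Vec; _∷_; foldr′; map; replicate; sum; zipWith; _[_]≔_)
open import Data.Vec.Relation.Unary.All using (All; _∷_)
open import Level using (0ℓ)
open import Relation.Binary.PropositionalEquality using (_≡_)
open import Relation.Unary using (Pred; _∈_; _∩_; _∖_)

-- Vectors rather than functions Fin d → ℤ, so that _≡_ is equality of points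
-- without function extensionality.
ℤ^ : ℕ → Set
ℤ^ d = Vec ℤ d

module _ {d : ℕ} where

  infixl 6 _⊕_
  infix  8 ⊖_

  _⊕_ : ℤ^ d → ℤ^ d → ℤ^ d
  _⊕_ = zipWith ℤ._+_

  ⊖_ : ℤ^ d → ℤ^ d
  ⊖_ = map -_

  e : Fin d → ℤ^ d
  e i = replicate d 0ℤ [ i ]≔ 1ℤ

  𝔼 : Pred (ℤ^ d × ℤ^ d) 0ℓ
  𝔼 (u , v) = ∃[ i ] v ≡ u ⊕ e i

  reversal : Pred (ℤ^ d × ℤ^ d) 0ℓ → Pred (ℤ^ d × ℤ^ d) 0ℓ
  reversal X p = ∃[ u ] ∃[ v ] (u , v) ∈ X × p ≡ (⊖ v , ⊖ u)

Positive : ∀ {d} → Vec ℕ d → Set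
Positive = All (0 <_)

RelativelyPrime : ∀ {d} → Vec ℕ d → Set
RelativelyPrime a = foldr′ gcd 0 a ≡ 1

sum-nonZero : ∀ {d} {a : Vec ℕ d} → 2 ≤ d → Positive a → NonZero (sum a)
sum-nonZero {a = suc _ ∷ _} _ _ = _
sum-nonZero {a = zero ∷ _} _ (() ∷ _)

module Christoffel {d : ℕ} (a : Vec ℕ d) .{{_ : NonZero (sum a)}} where

  s : ℕ
  s = sum a

  -- Fin s stands for ℤ/sℤ identified with {0,…,s-1}; _%ℕ_ returns the
  -- remainder in that range also for negative dividends.
  𝓕 : ℤ^ d → Fin s
  𝓕 x = fromℕ< {a∙x %ℕ s} (n%ℕd<d a∙x s)
    where a∙x = foldr′ ℤ._+_ 0ℤ (zipWith (λ aᵢ xᵢ → + aᵢ ℤ.* xᵢ) a x)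

  𝓗 : Pred (ℤ^ d × ℤ^ d) 0ℓ
  𝓗 = 𝔼 ∩ λ (u , v) → 𝓕 u Fin.< 𝓕 v

  𝓠 : Pred (ℤ^ d × ℤ^ d) 0ℓ
  𝓠 = 𝔼 ∩ λ (u , v) → toℕ (𝓕 u) ≡ 0 ⊎ toℕ (𝓕 v) ≡ 0

  body : Pred (ℤ^ d × ℤ^ d) 0ℓ → Pred (ℤ^ d × ℤ^ d) 0ℓ
  body X = X ∖ 𝓠

{-# OPTIONS --safe #-}
-- 𝓕 (⊖ x) is s ∸ 𝓕 x unless 𝓕 x = 0, so away from 𝓠 the negation of points reverses
-- the order of 𝓕-values. As it also swaps the two ends of an edge, 𝓕 still increases
-- along the reversed edge.
module Submission where

open import Defs
open import Data.Fin using (toℕ)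
open import Data.Fin.Properties using (toℕ-fromℕ<; toℕ<n; toℕ≤n)
open import Data.Integer using (ℤ; +_; -[1+_]; -_; 0ℤ; _%ℕ_)
import Data.Integer as ℤ using (_+_; _*_)
import Data.Integer.Properties as ℤ
open import Data.Nat using (ℕ; zero; suc; _≤_; _<_; _∸_; _%_; NonZero)
open import Data.Nat.DivMod using (m%n≤n)
open import Data.Nat.Properties using (m∸[m∸n]≡n; m>n⇒m∸n≢0; ∸-monoʳ-<)
open import Data.Product using (_,_)
open import Data.Sum using (inj₁; inj₂)
open import Data.Vec using (Vec; []; _∷_; foldr′; sum; zipWith)
open import Function using (_∘_)
open import Relation.Binary.PropositionalEquality
open import Relation.Nullary using (contradiction)
open import Relation.Unary using (_∈_; _⊆_; _≐_)

-- Since `𝓕` is the residue of a linear form, a nonzero residue `r` at `x` becomes `s ∸ r` at `⊖ x`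
-- (`𝓕-⊖`), which is again nonzero. So reversing an edge with both values nonzero keeps it off `𝓠`,
-- and the two order reversals, of values and of endpoints, cancel (`body-𝓗-reverse`). As reversal
-- is an involution, this one closure property yields both inclusions.

-‿%ℕ : ∀ i n .{{_ : NonZero n}} → i %ℕ n ≢ 0 → (- i) %ℕ n ≡ n ∸ i %ℕ n
-- Exposing the divisor as a successor lets `0 % n` compute.
-‿%ℕ (+ zero) (suc _) 0%n≢0 = contradiction refl 0%n≢0
-‿%ℕ (+ suc k) n i%n≢0 with suc k % n
... | zero  = contradiction refl i%n≢0
... | suc _ = refl
-‿%ℕ -[1+ k ] n i%n≢0 with suc k % n | m%n≤n (suc k) n
... | zero  | _   = contradiction refl i%n≢0
-- Here `i %ℕ n` is itself a truncated difference `n ∸ r`, and `r ≤ n` makes the second subtraction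
-- undo it.
... | suc _ | r≤n = sym (m∸[m∸n]≡n r≤n)

-i≡-[i+j]+j : ∀ i j → - i ≡ - (i ℤ.+ j) ℤ.+ j
-i≡-[i+j]+j i j = begin
  - i                    ≡⟨ ℤ.+-identityʳ (- i) ⟨
  - i ℤ.+ 0ℤ             ≡⟨ cong (λ k → - i ℤ.+ k) (ℤ.+-inverseˡ j) ⟨
  - i ℤ.+ (- j ℤ.+ j)    ≡⟨ ℤ.+-assoc (- i) (- j) j ⟨
  - i ℤ.+ - j ℤ.+ j      ≡⟨ cong (ℤ._+ j) (ℤ.neg-distrib-+ i j) ⟨
  - (i ℤ.+ j) ℤ.+ j      ∎
  where open ≡-Reasoning

⊖u≡⊖[u⊕w]⊕w : ∀ {d} (u w : ℤ^ d) → ⊖ u ≡ ⊖ (u ⊕ w) ⊕ w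
⊖u≡⊖[u⊕w]⊕w []      []      = refl
⊖u≡⊖[u⊕w]⊕w (x ∷ u) (y ∷ w) = cong₂ _∷_ (-i≡-[i+j]+j x y) (⊖u≡⊖[u⊕w]⊕w u w)

⊖-involutive : ∀ {d} (u : ℤ^ d) → ⊖ (⊖ u) ≡ u
⊖-involutive []      = refl
⊖-involutive (x ∷ u) = cong₂ _∷_ (ℤ.neg-involutive x) (⊖-involutive u)

-- The direction `i` is unchanged: `v = u + eᵢ` gives `-u = -v + eᵢ`.
𝔼-reverse : ∀ {d} {u v : ℤ^ d} → (u , v) ∈ 𝔼 → (⊖ v , ⊖ u) ∈ 𝔼
𝔼-reverse {u = u} (i , refl) = i , ⊖u≡⊖[u⊕w]⊕w u (e i)

infixl 7 _∙_

-- Copies the local `a∙x` of `𝓕` verbatim, so the two agree definitionally.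
_∙_ : ∀ {d} → Vec ℕ d → ℤ^ d → ℤ
a ∙ x = foldr′ ℤ._+_ 0ℤ (zipWith (λ aᵢ xᵢ → + aᵢ ℤ.* xᵢ) a x)

∙-⊖ : ∀ {d} (a : Vec ℕ d) x → a ∙ ⊖ x ≡ - (a ∙ x)
∙-⊖ []       []      = refl
∙-⊖ (aᵢ ∷ a) (y ∷ x) = begin
  + aᵢ ℤ.* - y ℤ.+ a ∙ ⊖ x        ≡⟨ cong₂ ℤ._+_ (sym (ℤ.neg-distribʳ-* (+ aᵢ) y)) (∙-⊖ a x) ⟩
  - (+ aᵢ ℤ.* y) ℤ.+ - (a ∙ x)    ≡⟨ ℤ.neg-distrib-+ (+ aᵢ ℤ.* y) (a ∙ x) ⟨
  - (+ aᵢ ℤ.* y ℤ.+ a ∙ x)        ∎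
  where open ≡-Reasoning

module _ {d : ℕ} (a : Vec ℕ d) .{{_ : NonZero (sum a)}} where
  open Christoffel a

  toℕ-𝓕 : ∀ x → toℕ (𝓕 x) ≡ a ∙ x %ℕ s
  toℕ-𝓕 x = toℕ-fromℕ< _

  𝓕-⊖ : ∀ x → toℕ (𝓕 x) ≢ 0 → toℕ (𝓕 (⊖ x)) ≡ s ∸ toℕ (𝓕 x)
  𝓕-⊖ x 𝓕x≢0 = begin
    toℕ (𝓕 (⊖ x))     ≡⟨ toℕ-𝓕 (⊖ x) ⟩
    a ∙ ⊖ x %ℕ s      ≡⟨ cong (_%ℕ s) (∙-⊖ a x) ⟩
    (- (a ∙ x)) %ℕ s  ≡⟨ -‿%ℕ (a ∙ x) s (𝓕x≢0 ∘ trans (toℕ-𝓕 x)) ⟩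
    s ∸ a ∙ x %ℕ s    ≡⟨ cong (s ∸_) (toℕ-𝓕 x) ⟨
    s ∸ toℕ (𝓕 x)     ∎
    where open ≡-Reasoning

  -- Residues are strictly below `s`, so `s ∸ 𝓕 x` cannot vanish.
  𝓕-⊖≢0 : ∀ x → toℕ (𝓕 x) ≢ 0 → toℕ (𝓕 (⊖ x)) ≢ 0
  𝓕-⊖≢0 x 𝓕x≢0 = m>n⇒m∸n≢0 (toℕ<n (𝓕 x)) ∘ trans (sym (𝓕-⊖ x 𝓕x≢0))

  body-𝓗-reverse : ∀ {u v} → (u , v) ∈ body 𝓗 → (⊖ v , ⊖ u) ∈ body 𝓗
  body-𝓗-reverse {u} {v} ((uv∈𝔼 , 𝓕u<𝓕v) , uv∉𝓠) =
    (𝔼-reverse uv∈𝔼 , 𝓕⊖v<𝓕⊖u) , λ where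
      (_ , inj₁ 𝓕⊖v≡0) → 𝓕-⊖≢0 v 𝓕v≢0 𝓕⊖v≡0
      (_ , inj₂ 𝓕⊖u≡0) → 𝓕-⊖≢0 u 𝓕u≢0 𝓕⊖u≡0
    where
    𝓕u≢0 : toℕ (𝓕 u) ≢ 0
    𝓕u≢0 𝓕u≡0 = uv∉𝓠 (uv∈𝔼 , inj₁ 𝓕u≡0)

    𝓕v≢0 : toℕ (𝓕 v) ≢ 0
    𝓕v≢0 𝓕v≡0 = uv∉𝓠 (uv∈𝔼 , inj₂ 𝓕v≡0)

    𝓕⊖v<𝓕⊖u : toℕ (𝓕 (⊖ v)) < toℕ (𝓕 (⊖ u))
    𝓕⊖v<𝓕⊖u = subst₂ _<_ (sym (𝓕-⊖ v 𝓕v≢0)) (sym (𝓕-⊖ u 𝓕u≢0))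
      (∸-monoʳ-< 𝓕u<𝓕v (toℕ≤n (𝓕 v)))

  reversal-body-𝓗 : reversal (body 𝓗) ≐ body 𝓗
  reversal-body-𝓗 = reversal⊆body , body⊆reversal
    where
    reversal⊆body : reversal (body 𝓗) ⊆ body 𝓗
    reversal⊆body (_ , _ , uv∈body , refl) = body-𝓗-reverse uv∈body

    body⊆reversal : body 𝓗 ⊆ reversal (body 𝓗)
    body⊆reversal {u , v} uv∈body =
      -- The preimage of an edge under reversal is its own reverse.
      ⊖ v , ⊖ u , body-𝓗-reverse uv∈body ,
      sym (cong₂ _,_ (⊖-involutive u) (⊖-involutive v))

lemma22 : (d : ℕ) (d≥2 : 2 ≤ d) (a : Vec ℕ d) (a>0 : Positive a) →
    RelativelyPrime a →
    let open Christoffel a {{sum-nonZero d≥2 a>0}} in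
    reversal (body 𝓗) ≐ body 𝓗
lemma22 d d≥2 a a>0 _ = reversal-body-𝓗 a {{sum-nonZero d≥2 a>0}}
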